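{- Let $\Sigma,\mathcal R$ be a theory and let $\mathcal M=(\mathcal D^1,\dots,\mathcal D^n)$ be a model of $\Sigma,\mathcal R$ valued in some $\Pi$-algebra $\mathcal B$. Then, for every judgment $x_1:A_1,\dots,x_p:A_p\vdash t:B$ derivable in the $\lambda\Pi$-calculus modulo $\Sigma,\mathcal R$, and for every sequence of valuations $\overline\phi=\phi_1,\dots,\phi_{n-1}$ of the context $x_1:A_1,\dots,x_p:A_p$, we have $$\llbracket A_1\rrbracket_{\overline\phi}\;\tilde\wedge\;\cdots\;\tilde\wedge\;\llbracket A_p\rrbracket_{\overline\phi}\;\le\;\llbracket B\rrbracket_{\overline\phi}$$ (the left-hand side being $\tilde\top$ when $p=0$).
   Context: **Terms.** Terms are $t ::= x\mid Type\mid Kind\mid \Pi x:t\;t\mid\lambda x:t\;t\mid t\,t$, up to $\alpha$-equivalence; $(u/x)t$ is capture-avoiding substitution; $A\to B$ is $\Pi x:A\;B$ with $x$ not free in $B$. $\beta$ is root $\beta$-reduction. For a relation $r$ on terms, $\longrightarrow^1_r$ is its closure under term formation, $\longrightarrow^*_r$ the reflexive-transitive closure of $\longrightarrow_r^1$, and $\equiv_r$ its reflexive-symmetric-transitive closure. **Theories.** A rewrite rule is a triple $l\longrightarrow^{\Gamma}r$ with $\Gamma$ a context and $l,r$ $\beta$-normal; it is well-typed in a context $\Sigma$ if, in the $\lambda\Pi$-calculus, $\Sigma,\Gamma$ is well-formed and $l,r$ have a common type $A$ in $\Sigma,\Gamma$. A theory $\Sigma,\mathcal R$ is a context $\Sigma$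 well-formed in the $\lambda\Pi$-calculus (its variables are called constants) and a set $\mathcal R$ of rewrite rules well-typed in $\Sigma$. $t\,\mathcal R\,u$ (root reduction) means $t=\theta l$, $u=\theta r$ for some rule $l\longrightarrow^\Gamma r$ and substitution $\theta$ of the variables of $\Gamma$. $\beta\mathcal R$ is the union of $\beta$ and $\mathcal R$. **Typing in the $\lambda\Pi$-calculus modulo $\Sigma,\mathcal R$.** (Empty) $[\,]$ is well-formed. (Declaration) if $\Gamma\vdash A:Type$ or $\Gamma\vdash A:Kind$, and $x\notin\Sigma,\Gamma$, then $\Gamma,x:A$ is well-formed. (Sort) if $\Gamma$ is well-formed, $\Gamma\vdash Type:Kind$. (Variable) if $\Gamma$ is well-formed and $x:A\in\Sigma,\Gamma$ then $\Gamma\vdash x:A$. For $s\in\{Type,Kind\}$: (Product) if $\Gamma\vdash A:Type$ and $\Gamma,x:A\vdash B:s$ then $\Gamma\vdash\Pi x:A\;B:s$; (Abstraction) if moreover $\Gamma,x:A\vdash t:B$ then $\Gamma\vdash\lambda x:A\;t:\Pi x:A\;B$. (Application) if $\Gamma\vdash t:\Pi x:A\;B$ and $\Gamma\vdash u:A$ then $\Gamma\vdash(t\,u):(u/x)B$. (Conversion) for $s\in\{Type,Kind\}$, if $\Gamma\vdash A:s$, $\Gamma\vdash B:s$, $\Gamma\vdash t:A$ and $A\equiv_{\beta\mathcal R}B$ then $\Gamma\vdash t:B$. The plain $\lambda\Pi$-calculus is the case where $\Sigma$ and $\mathcal R$ are empty. Throughout, $\longrightarrow^1_{\beta\mathcal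 R}$ is assumed confluent and to have the subject reduction property. **$\Pi$-algebras.** A $\Pi$-algebra is a set $\mathcal B$ with a pre-order $\le$, an element $\tilde\top$, a function $\tilde\wedge:\mathcal B\times\mathcal B\to\mathcal B$, a subset $\mathcal A$ of the set $\mathcal P^+(\mathcal B)$ of non-empty subsets of $\mathcal B$, and a function $\tilde\Pi:\mathcal B\times\mathcal A\to\mathcal B$, such that $a\le\tilde\top$ for all $a$; $a\,\tilde\wedge\,b$ is a greatest lower bound of $\{a,b\}$; and $a\le\tilde\Pi(b,S)$ iff $a\,\tilde\wedge\,b\le c$ for all $c\in S$. **Models.** A model is a family $\mathcal D^1,\dots,\mathcal D^n$ ($n\ge2$) of functions. $\mathcal D^i$ maps each term $t$ of type $B$ in some context $\Gamma$ (in the calculus modulo $\Sigma,\mathcal R$), and valuations $\phi_1,\dots,\phi_{i-1}$, where $\phi_j$ maps each $x:A$ of $\Gamma$ to an element of $\mathcal D^j_{A,\phi_1,\dots,\phi_{j-1}}$, to some $\mathcal D^i_{t,\phi_1,\dots,\phi_{i-1}}$, which for $i\ge2$ lies in $\mathcal D^{i-1}_{B,\phi_1,\dots,\phi_{i-2}}$; the functions are also defined on $Kind$ (without membership condition). The value depends only on $t$ and on the values of the valuations on variables free in $t$. Write $\llbracket t\rrbracket_{\phi_1,\dots,\phi_{n-1}}$ for $\mathcal D^n_{t,\phi_1,\dots,\phi_{n-1}}$. It is required that, for all $t,u$ and valuations (with $u$ of the declared type of $x$), $$\llbracket(u/x)t\rrbracket_{\phi_1,\dots,\phi_{n-1}}=\llbracket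 t\rrbracket_{(\phi_1,x=\mathcal D^1_u),\dots,(\phi_{n-1},x=\mathcal D^{n-1}_{u,\phi_1,\dots,\phi_{n-2}})}.$$ The model is valued in $\mathcal B$ if $\mathcal D^{n-1}_{Kind,\phi_1,\dots,\phi_{n-2}}=\mathcal D^{n-1}_{Type,\phi_1,\dots,\phi_{n-2}}=\mathcal B$, $\llbracket Kind\rrbracket_{\overline\phi}=\llbracket Type\rrbracket_{\overline\phi}=\tilde\top$, and $$\llbracket\Pi x:C\;D\rrbracket_{\overline\phi}=\tilde\Pi(\llbracket C\rrbracket_{\overline\phi},\{\llbracket D\rrbracket_{(\phi_1,x=c_1),\dots,(\phi_{n-1},x=c_{n-1})}\mid c_1\in\mathcal D^1_C,\dots,c_{n-1}\in\mathcal D^{n-1}_{C,\phi_1,\dots,\phi_{n-2}}\}).$$ A model valued in $\mathcal B$ is a model of $\Sigma,\mathcal R$ if $\llbracket A\rrbracket\ge\tilde\top$ for every constant $c:A$ in $\Sigma$, and for all $A,B$ well-typed in a context $\Gamma$ with $A\equiv_{\beta\mathcal R}B$, all $i$ and all valuations $\overline\phi$, $\mathcal D^i_{A,\overline\phi}=\mathcal D^i_{B,\overline\phi}$.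
   Formalization: In the substitution condition on models, the j-th valuation is extended by x = D^{j+1}_{u,φ_1,…,φ_j} instead of the printed D^j_u, which need not lie in D^j_A and so would not give a valuation. -}

module Defs where

open import Data.Bool.Base using (if_then_else_)
open import Data.Fin.Base using (Fin; zero; suc)
open import Data.List.Base using (List; []; _∷_; _++_; map)
open import Data.List.Relation.Unary.Any using (there)
open import Data.List.Membership.Propositional using (_∈_; _∉_)
open import Data.Nat.Base using (ℕ; suc; _+_; _≤_; _<_)
open import Data.Nat.Properties using (_≟_; <⇒≤; n<1+n; m<n⇒m<1+n)
open import Data.Product.Base using (Σ-syntax; ∃; ∃-syntax; _×_; _,_; proj₁; proj₂)
open import Data.Sum.Base using (_⊎_)
open import Data.Unit.Polymorphic.Base using (⊤)
open import Data.Empty using (⊥)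
open import Data.Vec.Base as Vec using (Vec; []; _∷_)
open import Data.Vec.Relation.Binary.Pointwise.Inductive using (Pointwise)
open import Function.Base using (_∘_)
open import Function.Bundles using (_⇔_)
open import Level using (Level; 0ℓ; _⊔_) renaming (suc to lsuc)
open import Algebra.Core using (Op₂)
open import Algebra.Definitions using (Congruent₂)
open import Relation.Binary.Bundles using (Setoid)
open import Relation.Binary.Construct.Closure.Equivalence using (EqClosure)
import Relation.Binary.Construct.Union as Rel₂
open import Relation.Binary.Core using (Rel)
open import Relation.Binary.Definitions using (Maximum; _Respects_)
open import Relation.Binary.Lattice.Definitions using (Infimum)
open import Relation.Binary.PropositionalEquality.Core using (_≡_)
open import Relation.Binary.Rewriting using (Confluent; IsNormalForm)
open import Relation.Binary.Structures using (IsPreorder)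
open import Relation.Nullary.Decidable.Core using (does)
open import Relation.Unary using (Pred; Satisfiable; _≐_; ∅)

private
  variable
    m n : ℕ

-- Locally nameless: free variables (including constants) carry names,
-- bound ones are de Bruijn indices, so α-equivalence is equality.  The
-- terms of the calculus are those of Term 0.

Name : Set
Name = ℕ

data Sort : Set where
  type kind : Sort

infixl 7 _·_

data Term (n : ℕ) : Set where
  bvar : Fin n → Term n
  fvar : Name → Term n
  sort : Sort → Term n
  pi   : Term n → Term (suc n) → Term n
  lam  : Term n → Term (suc n) → Term n
  _·_  : Term n → Term n → Term n

pattern Type = sort type
pattern Kind = sort kind

_∈fv_ : Name → Term n → Set
x ∈fv bvar i  = ⊥
x ∈fv fvar y  = x ≡ y
x ∈fv sort s  = ⊥
x ∈fv pi A B  = x ∈fv A ⊎ x ∈fv B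
x ∈fv lam A t = x ∈fv A ⊎ x ∈fv t
x ∈fv (t · u) = x ∈fv t ⊎ x ∈fv u

lift : (Fin m → Fin n) → Fin (suc m) → Fin (suc n)
lift ρ zero    = zero
lift ρ (suc i) = suc (ρ i)

rename : (Fin m → Fin n) → Term m → Term n
rename ρ (bvar i)  = bvar (ρ i)
rename ρ (fvar x)  = fvar x
rename ρ (sort s)  = sort s
rename ρ (pi A B)  = pi (rename ρ A) (rename (lift ρ) B)
rename ρ (lam A t) = lam (rename ρ A) (rename (lift ρ) t)
rename ρ (t · u)   = rename ρ t · rename ρ u

lifts : (Fin m → Term n) → Fin (suc m) → Term (suc n)
lifts σ zero    = bvar zero
lifts σ (suc i) = rename suc (σ i)

-- Simultaneous capture-avoiding substitution of the dangling indices
-- (by σ) and of the free names (by θ).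
sub : (Fin m → Term n) → (Name → Term n) → Term m → Term n
sub σ θ (bvar i)  = σ i
sub σ θ (fvar x)  = θ x
sub σ θ (sort s)  = sort s
sub σ θ (pi A B)  = pi (sub σ θ A) (sub (lifts σ) (rename suc ∘ θ) B)
sub σ θ (lam A t) = lam (sub σ θ A) (sub (lifts σ) (rename suc ∘ θ) t)
sub σ θ (t · u)   = sub σ θ t · sub σ θ u

infix 8 _↦_

_↦_ : Name → Term n → Name → Term n
(x ↦ u) y = if does (y ≟ x) then u else fvar y

[_/_]_ : Term n → Name → Term n → Term n
[ u / x ] t = sub bvar (x ↦ u) t

abs : Name → Term n → Term (suc n)
abs x = sub (bvar ∘ suc) (x ↦ bvar zero)

-- x may be free in B and is bound in Π[ x ∶ A ] B.
Π[_∶_]_ ƛ[_∶_]_ : Name → Term n → Term n → Term n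
Π[ x ∶ A ] B = pi A (abs x B)
ƛ[ x ∶ A ] t = lam A (abs x t)

infix 7 Π[_∶_]_ ƛ[_∶_]_ [_/_]_

inst : Term (suc n) → Term n → Term n
inst {n} t u = sub σ fvar t
  where
  σ : Fin (suc n) → Term n
  σ zero    = u
  σ (suc i) = bvar i

-- The most recent declaration comes first, so the context
-- written Σ , Γ is Γ ++ Σ.

Ctx : Set
Ctx = List (Name × Term 0)

infixl 5 _,_∶_

pattern _,_∶_ Γ x A = (x , A) ∷ Γ

dom : Ctx → List Name
dom = map proj₁

-- Root relations are given on all Term n, so that they apply under
-- binders to subterms with dangling indices.

TermRel : (r : Level) → Set (lsuc r)
TermRel r = ∀ {n} → Rel (Term n) r

data Closure {r : Level} (R : TermRel r) {n : ℕ} : Rel (Term n) r where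
  root : ∀ {t t′} → R t t′ → Closure R t t′
  piˡ  : ∀ {A A′ B} → Closure R A A′ → Closure R (pi A B) (pi A′ B)
  piʳ  : ∀ {A B B′} → Closure R B B′ → Closure R (pi A B) (pi A B′)
  lamˡ : ∀ {A A′ t} → Closure R A A′ → Closure R (lam A t) (lam A′ t)
  lamʳ : ∀ {A t t′} → Closure R t t′ → Closure R (lam A t) (lam A t′)
  appˡ : ∀ {t t′ u} → Closure R t t′ → Closure R (t · u) (t′ · u)
  appʳ : ∀ {t u u′} → Closure R u u′ → Closure R (t · u) (t · u′)

data Beta {n : ℕ} : Rel (Term n) 0ℓ where
  β : ∀ {A t u} → Beta (lam A t · u) (inst t u)

record Rule : Set where
  field
    Γ      : Ctx
    l r    : Term 0
    l-βnf  : IsNormalForm (Closure Beta) l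
    r-βnf  : IsNormalForm (Closure Beta) r

-- θ substitutes the variables of the rule's context and nothing else;
-- in particular it leaves the constants alone.
data Root {r : Level} (𝓡 : Pred Rule r) {n : ℕ} : Rel (Term n) r where
  rule : ∀ {ρ} → 𝓡 ρ → (θ : Name → Term n) →
         (∀ {x} → x ∉ dom (Rule.Γ ρ) → θ x ≡ fvar x) →
         Root 𝓡 (sub (λ ()) θ (Rule.l ρ)) (sub (λ ()) θ (Rule.r ρ))

BetaRoot : ∀ {r} → Pred Rule r → TermRel r
BetaRoot 𝓡 = Beta Rel₂.∪ Root 𝓡

module Typing {r : Level} (Sg : Ctx) (𝓡 : Pred Rule r) where

  infix 4 _⟶_ _≡βR_ _⊢_∶_ _⊩_

  _⟶_ : Rel (Term 0) r
  _⟶_ = Closure (BetaRoot 𝓡)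

  _≡βR_ : Rel (Term 0) r
  _≡βR_ = EqClosure _⟶_

  data WF : Ctx → Set r
  data _⊢_∶_ (Γ : Ctx) : Term 0 → Term 0 → Set r

  data WF where
    empty   : WF []
    declare : ∀ {Γ x A} s → Γ ⊢ A ∶ sort s → x ∉ dom (Γ ++ Sg) →
              WF (Γ , x ∶ A)

  data _⊢_∶_ Γ where
    srt  : WF Γ → Γ ⊢ Type ∶ Kind
    var  : ∀ {x A} → WF Γ → (x , A) ∈ Γ ++ Sg → Γ ⊢ fvar x ∶ A
    prod : ∀ {x A B} s → Γ ⊢ A ∶ Type → Γ , x ∶ A ⊢ B ∶ sort s →
           Γ ⊢ Π[ x ∶ A ] B ∶ sort s
    abst : ∀ {x A B t} s → Γ ⊢ A ∶ Type → Γ , x ∶ A ⊢ B ∶ sort s →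
           Γ , x ∶ A ⊢ t ∶ B →
           Γ ⊢ ƛ[ x ∶ A ] t ∶ Π[ x ∶ A ] B
    app  : ∀ {x A B t u} → Γ ⊢ t ∶ Π[ x ∶ A ] B → Γ ⊢ u ∶ A →
           Γ ⊢ t · u ∶ [ u / x ] B
    conv : ∀ {A B t} s → Γ ⊢ A ∶ sort s → Γ ⊢ B ∶ sort s → Γ ⊢ t ∶ A →
           A ≡βR B → Γ ⊢ t ∶ B

  wf : ∀ {Γ t B} → Γ ⊢ t ∶ B → WF Γ
  wf (srt w)        = w
  wf (var w _)      = w
  wf (prod _ d _)   = wf d
  wf (abst _ d _ _) = wf d
  wf (app d _)      = wf d
  wf (conv _ d _ _ _) = wf d

  -- The terms that a model interprets in context Γ.
  data _⊩_ (Γ : Ctx) : Term 0 → Set r where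
    typed : ∀ {t B} → Γ ⊢ t ∶ B → Γ ⊩ t
    kind  : WF Γ → Γ ⊩ Kind

  SubjectReduction : Set r
  SubjectReduction = ∀ {Γ t u A} → Γ ⊢ t ∶ A → t ⟶ u → Γ ⊢ u ∶ A

module λΠ = Typing [] ∅

WellTyped : Ctx → Rule → Set
WellTyped Sg ρ = λΠ.WF (Γ ++ Sg) ×
                 ∃[ A ] (Γ ++ Sg λΠ.⊢ l ∶ A) × (Γ ++ Sg λΠ.⊢ r ∶ A)
  where open Rule ρ

record Theory (r : Level) : Set (lsuc r) where
  field
    Sg         : Ctx
    𝓡          : Pred Rule r
    Sg-wf      : λΠ.WF Sg
    𝓡-wellTyped : ∀ {ρ} → 𝓡 ρ → WellTyped Sg ρ

  open Typing Sg 𝓡 public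

-- A model interprets a term both as an element of a set and as a set of
-- interpretations of other terms, so its values live in an untyped
-- universe of sets: Aczel's iterative sets with extensional equality.

data V (ℓ : Level) : Set (lsuc ℓ) where
  sup : (I : Set ℓ) → (I → V ℓ) → V ℓ

module _ {ℓ : Level} where

  infix 4 _≈_ _∈ᵛ_

  _≈_ : Rel (V ℓ) ℓ
  sup I f ≈ sup J g = (∀ i → ∃[ j ] f i ≈ g j) × (∀ j → ∃[ i ] f i ≈ g j)

  _∈ᵛ_ : Rel (V ℓ) ℓ
  v ∈ᵛ sup I f = ∃[ i ] v ≈ f i

  ≈-refl : ∀ {v} → v ≈ v
  ≈-refl {sup I f} = (λ i → i , ≈-refl) , (λ i → i , ≈-refl)

  ≈-sym : ∀ {v w} → v ≈ w → w ≈ v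
  ≈-sym {sup I f} {sup J g} (p , q) =
    (λ j → proj₁ (q j) , ≈-sym (proj₂ (q j))) ,
    (λ i → proj₁ (p i) , ≈-sym (proj₂ (p i)))

  ≈-trans : ∀ {u v w} → u ≈ v → v ≈ w → u ≈ w
  ≈-trans {sup I f} {sup J g} {sup K h} (p , q) (p′ , q′) =
    (λ i → let j , e = p i ; k , e′ = p′ j in k , ≈-trans e e′) ,
    (λ k → let j , e′ = q′ k ; i , e = q j in i , ≈-trans e e′)

  ∈-respʳ-≈ : ∀ {v a b} → a ≈ b → v ∈ᵛ a → v ∈ᵛ b
  ∈-respʳ-≈ {a = sup I f} {b = sup J g} (p , _) (i , e) =
    let j , e′ = p i in j , ≈-trans e e′

  El : V ℓ → Setoid (lsuc ℓ) ℓ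
  El a = record
    { Carrier       = Σ[ v ∈ V ℓ ] v ∈ᵛ a
    ; _≈_           = λ v w → proj₁ v ≈ proj₁ w
    ; isEquivalence = record { refl = ≈-refl ; sym = ≈-sym ; trans = ≈-trans }
    }

-- Subsets are predicates; the -resp and -cong fields say that subsets and
-- functions respect the equality of the underlying setoid.

record ΠAlgebra {c e : Level} (B : Setoid c e) (o s a : Level)
                : Set (c ⊔ e ⊔ lsuc (o ⊔ s ⊔ a)) where
  open Setoid B renaming (_≈_ to _≋_) using (Carrier)
  infix  4 _≤̃_
  infixl 7 _∧̃_
  field
    _≤̃_        : Rel Carrier o
    isPreorder : IsPreorder _≋_ _≤̃_
    ⊤̃          : Carrier
    _∧̃_        : Op₂ Carrier
    ∧̃-cong     : Congruent₂ _≋_ _∧̃_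
    𝒜          : Pred (Pred Carrier s) a
    𝒜-nonEmpty : ∀ {S} → 𝒜 S → Satisfiable S
    𝒜-member-resp : ∀ {S} → 𝒜 S → S Respects _≋_
    𝒜-resp     : ∀ {S T} → S ≐ T → 𝒜 S → 𝒜 T
    Π̃          : Carrier → ∃ 𝒜 → Carrier
    Π̃-cong     : ∀ {b c S T} → b ≋ c → proj₁ S ≐ proj₁ T → Π̃ b S ≋ Π̃ c T
    ⊤̃-maximum  : Maximum _≤̃_ ⊤̃
    ∧̃-infimum  : Infimum _≤̃_ _∧̃_
    Π̃-adjoint  : ∀ {a b} S → (a ≤̃ Π̃ b S) ⇔ (∀ c → proj₁ S c → a ∧̃ b ≤̃ c)

-- The family consists of n = 2 + m functions, 𝒟 k being the one usually
-- written 𝒟^{k+1}, which takes k valuations.  Sequences of valuations are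
-- stored in reverse order: φ_k ∷ … ∷ φ_1 ∷ [].  The functions 𝒟 k and the
-- valuations are total, but constrained only on their intended domain:
-- terms interpretable in a context, and the variables of that context.

Valuation : (ℓ : Level) → Set (lsuc ℓ)
Valuation ℓ = Name → V ℓ

module _ {ℓ : Level} where

  at : ∀ {k} → Name → Vec (Valuation ℓ) k → Vec (V ℓ) k
  at x = Vec.map (λ φ → φ x)

  infixl 5 _,_≔_

  _,_≔_ : ∀ {k} → Vec (Valuation ℓ) k → Name → Vec (V ℓ) k → Vec (Valuation ℓ) k
  φ , x ≔ c = Vec.zipWith (λ ψ v y → if does (y ≟ x) then v else ψ y) φ c

module Interpretation (n : ℕ) {ℓ : Level}
  (𝒟 : ∀ k → .(k < n) → Term 0 → Vec (Valuation ℓ) k → V ℓ) where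

  -- c₁ ∈ 𝒟¹_A , … , c_k ∈ 𝒟^k_{A,φ₁,…,φ_{k-1}}
  Elements : ∀ {k} → .(k ≤ n) → Term 0 → Vec (Valuation ℓ) k → Vec (V ℓ) k → Set ℓ
  Elements p A []      []      = ⊤
  Elements p A (ψ ∷ φ) (c ∷ cs) =
    (c ∈ᵛ 𝒟 _ p A φ) × Elements (<⇒≤ p) A φ cs

  -- φ is a sequence of valuations of the context Γ.
  Valuates : ∀ {k} → .(k ≤ n) → Ctx → Vec (Valuation ℓ) k → Set ℓ
  Valuates p Γ φ = ∀ {x A} → (x , A) ∈ Γ → Elements p A φ (at x φ)

  -- 𝒟²_{u,φ₁} , … , 𝒟^{k+1}_{u,φ₁,…,φ_k}
  values : ∀ {k} → .(k < n) → Term 0 → Vec (Valuation ℓ) k → Vec (V ℓ) k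
  values p u []      = []
  values p u (ψ ∷ φ) = 𝒟 _ p u (ψ ∷ φ) ∷ values (<⇒≤ p) u φ

record Model {r : Level} (T : Theory r) (m : ℕ) (ℓ : Level)
             : Set (r ⊔ lsuc ℓ) where
  open Theory T

  field
    𝒟 : ∀ k → .(k < 2 + m) → Term 0 → Vec (Valuation ℓ) k → V ℓ

  open Interpretation (2 + m) 𝒟 public

  ⟦_⟧ : Term 0 → Vec (Valuation ℓ) (suc m) → V ℓ
  ⟦_⟧ = 𝒟 (suc m) (n<1+n (suc m))

  -- φ₁ , … , φ_{n-1} are valuations of Γ.
  _⊨_ : Vec (Valuation ℓ) (suc m) → Ctx → Set ℓ
  φ ⊨ Γ = Valuates (<⇒≤ (n<1+n (suc m))) Γ φ

  field
    𝒟-member : ∀ {k} .(p : suc k < 2 + m) {Γ t B} {φ : Vec (Valuation ℓ) k} {ψ} →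
      Γ ⊢ t ∶ B → Valuates (<⇒≤ p) Γ (ψ ∷ φ) →
      𝒟 (suc k) p t (ψ ∷ φ) ∈ᵛ 𝒟 k (<⇒≤ p) B φ

    -- Valuations are defined on the variables of the context only, not on
    -- the constants.
    𝒟-local : ∀ {k} .(p : k < 2 + m) {Γ Δ t} {φ ψ : Vec (Valuation ℓ) k} →
      Γ ⊩ t → Δ ⊩ t → Valuates (<⇒≤ p) Γ φ → Valuates (<⇒≤ p) Δ ψ →
      (∀ {x} → x ∈fv t → x ∈ dom Γ → Pointwise _≈_ (at x φ) (at x ψ)) →
      𝒟 k p t φ ≈ 𝒟 k p t ψ

    -- For u of type A it is 𝒟^{j+1}_u, not 𝒟^j_u, that is an element of
    -- 𝒟^j_A, where φ_j takes its values; hence the index shift in values.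
    ⟦⟧-subst : ∀ {Γ x A t u φ} →
      Γ , x ∶ A ⊩ t → Γ ⊢ u ∶ A → φ ⊨ Γ →
      ⟦ [ u / x ] t ⟧ φ ≈ ⟦ t ⟧ (φ , x ≔ values (n<1+n (suc m)) u φ)

  𝒟ₙ₋₁ : Term 0 → Vec (Valuation ℓ) m → V ℓ
  𝒟ₙ₋₁ = 𝒟 m (m<n⇒m<1+n (n<1+n m))

  _⊨ₙ₋₂_ : Vec (Valuation ℓ) m → Ctx → Set ℓ
  φ ⊨ₙ₋₂ Γ = Valuates (<⇒≤ (m<n⇒m<1+n (n<1+n m))) Γ φ

  ⊨-tail : ∀ {Γ φ} → φ ⊨ Γ → Vec.tail φ ⊨ₙ₋₂ Γ
  ⊨-tail {φ = ψ ∷ φ} v x∈Γ = proj₂ (v x∈Γ)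

  ⟦⟧-member : ∀ {Γ t B φ} → Γ ⊢ t ∶ B → φ ⊨ Γ → ⟦ t ⟧ φ ∈ᵛ 𝒟ₙ₋₁ B (Vec.tail φ)
  ⟦⟧-member {φ = ψ ∷ φ} d v = 𝒟-member _ d v

record ValuedIn {r ℓ : Level} {T : Theory r} {m : ℕ} (M : Model T m ℓ)
                (𝓑 : V ℓ) {o a : Level} (alg : ΠAlgebra (El 𝓑) o (lsuc ℓ) a)
                : Set (r ⊔ lsuc ℓ ⊔ o ⊔ a) where
  open Theory T
  open Model M
  open ΠAlgebra alg

  field
    𝒟-sort : ∀ {Γ φ} s → WF Γ → φ ⊨ₙ₋₂ Γ → 𝒟ₙ₋₁ (sort s) φ ≈ 𝓑
    ⟦sort⟧ : ∀ {Γ φ} s → WF Γ → φ ⊨ Γ → ⟦ sort s ⟧ φ ≈ proj₁ ⊤̃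

  ⟦_⟧∈𝓑 : ∀ {Γ A s φ} → Γ ⊢ A ∶ sort s → φ ⊨ Γ → ⟦ A ⟧ φ ∈ᵛ 𝓑
  ⟦_⟧∈𝓑 {s = s} d v =
    ∈-respʳ-≈ (𝒟-sort s (wf d) (⊨-tail v)) (⟦⟧-member d v)

  -- { ⟦ D ⟧_{(φ₁,x=c₁),…,(φ_{n-1},x=c_{n-1})} ∣ c_j ∈ 𝒟^j_{C,φ₁,…,φ_{j-1}} }
  Instances : Name → Term 0 → Term 0 → Vec (Valuation ℓ) (suc m) →
              Pred (Setoid.Carrier (El 𝓑)) (lsuc ℓ)
  Instances x C D φ b =
    ∃[ c ] Elements (<⇒≤ (n<1+n (suc m))) C φ c × proj₁ b ≈ ⟦ D ⟧ (φ , x ≔ c)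

  field
    ⟦Π⟧ : ∀ {Γ x C D s φ} (dC : Γ ⊢ C ∶ Type) → Γ , x ∶ C ⊢ D ∶ sort s →
      (v : φ ⊨ Γ) →
      Σ[ S∈𝒜 ∈ 𝒜 (Instances x C D φ) ]
        ⟦ Π[ x ∶ C ] D ⟧ φ ≈ proj₁ (Π̃ (⟦ C ⟧ φ , ⟦ dC ⟧∈𝓑 v) (_ , S∈𝒜))

  infix 4 _≤⟦_⟧_

  -- ⟦ A ⟧ φ is an element of 𝓑, and b ≤ ⟦ A ⟧ φ.
  _≤⟦_⟧_ : Setoid.Carrier (El 𝓑) → Term 0 → Vec (Valuation ℓ) (suc m) → Set (ℓ ⊔ o)
  b ≤⟦ A ⟧ φ = Σ[ A∈𝓑 ∈ ⟦ A ⟧ φ ∈ᵛ 𝓑 ] b ≤̃ (⟦ A ⟧ φ , A∈𝓑)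

  -- ⊤̃ ∧̃ ⟦ A₁ ⟧ φ ∧̃ … ∧̃ ⟦ A_p ⟧ φ
  ⋀ : ∀ {Γ φ} → WF Γ → φ ⊨ Γ → Setoid.Carrier (El 𝓑)
  ⋀ empty v = ⊤̃
  ⋀ {Γ , x ∶ A} {φ} (declare s d _) v =
    ⋀ {φ = φ} (wf d) (λ y∈Γ → v (there y∈Γ)) ∧̃
    (⟦ A ⟧ φ , ⟦_⟧∈𝓑 {φ = φ} d (λ y∈Γ → v (there y∈Γ)))

record IsModel {r ℓ : Level} {T : Theory r} {m : ℕ} {M : Model T m ℓ} {𝓑 : V ℓ}
               {o a : Level} {alg : ΠAlgebra (El 𝓑) o (lsuc ℓ) a}
               (val : ValuedIn M 𝓑 alg) : Set (r ⊔ lsuc ℓ ⊔ o) where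
  open Theory T
  open Model M
  open ΠAlgebra alg
  open ValuedIn val

  field
    constants : ∀ {c A φ} → (c , A) ∈ Sg → φ ⊨ [] → ⊤̃ ≤⟦ A ⟧ φ
    conversion : ∀ {k} .(p : k < 2 + m) {Γ A B C D} {φ : Vec (Valuation ℓ) k} →
      Γ ⊢ A ∶ C → Γ ⊢ B ∶ D → A ≡βR B → Valuates (<⇒≤ p) Γ φ →
      𝒟 k p A φ ≈ 𝒟 k p B φ

{-# OPTIONS --safe #-}

-- Induction on the derivation.  For an abstraction, the adjunction defining Π̃
-- turns the induction hypothesis, read at all extensions of the valuations, into
-- the claim.  For an application, the adjunction is used in the other direction at
-- the instance given by the argument, which is ⟦ [ u / x ] B ⟧ by the
-- substitution property of models; as models interpret well-typed terms only,
-- this requires the product to be well-typed, hence type correctness of the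
-- calculus: the type of a term is Kind or has itself a sort as type.

module Submission where

open import Defs
open import Data.Bool.Base using (if_then_else_)
open import Data.Empty using (⊥-elim)
open import Data.Fin.Base using (Fin; zero; suc)
open import Data.List.Base using (List; []; _∷_; _++_; concatMap)
open import Data.List.Extrema.Nat using (max; xs≤max)
open import Data.List.Membership.Propositional using (_∈_; _∉_; lose)
open import Data.List.Membership.Propositional.Properties
  using (∈-map⁺; ∈-map⁻; ∈-++⁺ˡ; ∈-++⁺ʳ; ∈-++⁻; ∈-concatMap⁺)
import Data.List.Membership.DecPropositional as DecMembership
open import Data.List.Relation.Unary.All using (lookup)
open import Data.List.Relation.Unary.Any using (here; there)
open import Data.Nat.Base using (ℕ; suc; _+_; _≤_; _<_)
open import Data.Nat.Properties using (_≟_; <⇒≤; n<1+n; 1+n≰n)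
open import Data.Product.Base using (∃-syntax; _×_; _,_; proj₁; proj₂)
open import Data.Sum.Base as Sum using (_⊎_; inj₁; inj₂; [_,_]′)
open import Data.Vec.Base using (Vec; []; _∷_)
open import Data.Vec.Relation.Binary.Pointwise.Inductive as Pointwise
  using (Pointwise; []; _∷_)
open import Function.Base using (_∘_; _$_; id)
open import Function.Bundles using (module Equivalence)
open import Level using (Level)
open import Relation.Binary.Bundles using (Setoid)
open import Relation.Binary.Construct.Closure.Equivalence using (gmap)
open import Relation.Binary.PropositionalEquality
  using (_≡_; _≢_; refl; sym; trans; cong; cong₂; subst; subst₂; module ≡-Reasoning)
open import Relation.Binary.Rewriting using (Confluent)
open import Relation.Binary.Structures using (IsPreorder)
open import Relation.Nullary using (¬_; yes; no)
open import Relation.Nullary.Decidable using (does; dec-true; dec-false; toSum)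
open import Relation.Unary using (Pred; ∅)

private
  variable
    k l m n : ℕ
    x y : Name

-- `x ↦ u` is `update fvar x u`, and each component of `φ , x ≔ c` is an update too, so the lemmas
-- below serve both substitutions and valuations.
update : ∀ {a} {A : Set a} → (Name → A) → Name → A → Name → A
update f x a y = if does (y ≟ x) then a else f y

module _ {a} {A : Set a} (f : Name → A) (x : Name) (b : A) where

  update-≡ : update f x b x ≡ b
  update-≡ = cong (if_then b else f x) (dec-true (x ≟ x) refl)

  update-≢ : y ≢ x → update f x b y ≡ f y
  update-≢ {y} y≢x = cong (if_then b else f y) (dec-false (y ≟ x) y≢x)

-- Packages the case split on `y ≟ x` for two updates at the same name; later proofs only have to
-- choose the relation `R`.
update-rel : ∀ {a b r} {A : Set a} {B : Set b} (R : A → B → Set r)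
  (f : Name → A) (g : Name → B) (x : Name) {a : A} {b : B} (y : Name) →
  R a b → (y ≢ x → R (f y) (g y)) → R (update f x a y) (update g x b y)
update-rel R f g x {a} {b} y Rab Rfg with y ≟ x
... | yes refl = subst₂ R (sym (update-≡ f x a)) (sym (update-≡ g x b)) Rab
... | no y≢x   = subst₂ R (sym (update-≢ f x a y≢x)) (sym (update-≢ g x b y≢x)) (Rfg y≢x)

-- Substitution calculus

-- The name substitutions are compared on the free names of `t` only. This is how freshness and
-- scoping facts become equations between substituted terms.
sub-cong : {σ σ′ : Fin m → Term n} {θ θ′ : Name → Term n} (t : Term m) →
  (∀ i → σ i ≡ σ′ i) → (∀ {x} → x ∈fv t → θ x ≡ θ′ x) → sub σ θ t ≡ sub σ′ θ′ t

lifts-cong : {σ σ′ : Fin m → Term n} → (∀ i → σ i ≡ σ′ i) → ∀ i → lifts σ i ≡ lifts σ′ i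
lifts-cong e zero    = refl
lifts-cong e (suc i) = cong (rename suc) (e i)

sub-cong (bvar i) e f  = e i
sub-cong (fvar x) e f  = f refl
sub-cong (sort s) e f  = refl
sub-cong (pi A B) e f  =
  cong₂ pi (sub-cong A e (f ∘ inj₁)) (sub-cong B (lifts-cong e) (cong (rename suc) ∘ f ∘ inj₂))
sub-cong (lam A t) e f =
  cong₂ lam (sub-cong A e (f ∘ inj₁)) (sub-cong t (lifts-cong e) (cong (rename suc) ∘ f ∘ inj₂))
sub-cong (t · u) e f   =
  cong₂ _·_ (sub-cong t e (f ∘ inj₁)) (sub-cong u e (f ∘ inj₂))

sub-cong-bvar : {σ σ′ : Fin m → Term n} {θ : Name → Term n} (t : Term m) →
  (∀ i → σ i ≡ σ′ i) → sub σ θ t ≡ sub σ′ θ t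
sub-cong-bvar t e = sub-cong t e (λ _ → refl)

lifts-bvar : (ρ : Fin m → Fin n) → ∀ i → bvar (lift ρ i) ≡ lifts (bvar ∘ ρ) i
lifts-bvar ρ zero    = refl
lifts-bvar ρ (suc i) = refl

rename≡sub : (ρ : Fin m → Fin n) (t : Term m) → rename ρ t ≡ sub (bvar ∘ ρ) fvar t
rename≡sub ρ (bvar i)  = refl
rename≡sub ρ (fvar x)  = refl
rename≡sub ρ (sort s)  = refl
rename≡sub ρ (pi A B)  = cong₂ pi (rename≡sub ρ A)
  (trans (rename≡sub (lift ρ) B) (sub-cong-bvar B (lifts-bvar ρ)))
rename≡sub ρ (lam A t) = cong₂ lam (rename≡sub ρ A)
  (trans (rename≡sub (lift ρ) t) (sub-cong-bvar t (lifts-bvar ρ)))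
rename≡sub ρ (t · u)   = cong₂ _·_ (rename≡sub ρ t) (rename≡sub ρ u)

lifts-lift : (σ : Fin m → Term n) (ρ : Fin l → Fin m) →
  ∀ i → lifts σ (lift ρ i) ≡ lifts (σ ∘ ρ) i
lifts-lift σ ρ zero    = refl
lifts-lift σ ρ (suc i) = refl

sub-rename : (σ : Fin m → Term n) (θ : Name → Term n) (ρ : Fin l → Fin m) (t : Term l) →
  sub σ θ (rename ρ t) ≡ sub (σ ∘ ρ) θ t
sub-rename σ θ ρ (bvar i)  = refl
sub-rename σ θ ρ (fvar x)  = refl
sub-rename σ θ ρ (sort s)  = refl
sub-rename σ θ ρ (pi A B)  = cong₂ pi (sub-rename σ θ ρ A)
  (trans (sub-rename (lifts σ) _ (lift ρ) B) (sub-cong-bvar B (lifts-lift σ ρ)))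
sub-rename σ θ ρ (lam A t) = cong₂ lam (sub-rename σ θ ρ A)
  (trans (sub-rename (lifts σ) _ (lift ρ) t) (sub-cong-bvar t (lifts-lift σ ρ)))
sub-rename σ θ ρ (t · u)   = cong₂ _·_ (sub-rename σ θ ρ t) (sub-rename σ θ ρ u)

rename-rename : (ρ : Fin m → Fin n) (ρ′ : Fin l → Fin m) (t : Term l) →
  rename ρ (rename ρ′ t) ≡ rename (ρ ∘ ρ′) t
rename-rename ρ ρ′ t = begin
  rename ρ (rename ρ′ t)              ≡⟨ rename≡sub ρ (rename ρ′ t) ⟩
  sub (bvar ∘ ρ) fvar (rename ρ′ t)   ≡⟨ sub-rename (bvar ∘ ρ) fvar ρ′ t ⟩
  sub (bvar ∘ ρ ∘ ρ′) fvar t          ≡⟨ rename≡sub (ρ ∘ ρ′) t ⟨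
  rename (ρ ∘ ρ′) t                   ∎
  where open ≡-Reasoning

rename-lift-suc : (ρ : Fin m → Fin n) (t : Term m) →
  rename (lift ρ) (rename suc t) ≡ rename suc (rename ρ t)
rename-lift-suc ρ t = trans (rename-rename (lift ρ) suc t) (sym (rename-rename suc ρ t))

lift-lifts : (ρ : Fin m → Fin n) (σ : Fin l → Term m) →
  ∀ i → rename (lift ρ) (lifts σ i) ≡ lifts (rename ρ ∘ σ) i
lift-lifts ρ σ zero    = refl
lift-lifts ρ σ (suc i) = rename-lift-suc ρ (σ i)

rename-sub : (ρ : Fin m → Fin n) (σ : Fin l → Term m) (θ : Name → Term m) (t : Term l) →
  rename ρ (sub σ θ t) ≡ sub (rename ρ ∘ σ) (rename ρ ∘ θ) t
rename-sub ρ σ θ (bvar i)  = refl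
rename-sub ρ σ θ (fvar x)  = refl
rename-sub ρ σ θ (sort s)  = refl
rename-sub ρ σ θ (pi A B)  = cong₂ pi (rename-sub ρ σ θ A)
  (trans (rename-sub (lift ρ) (lifts σ) _ B)
         (sub-cong B (lift-lifts ρ σ) (λ {x} _ → rename-lift-suc ρ (θ x))))
rename-sub ρ σ θ (lam A t) = cong₂ lam (rename-sub ρ σ θ A)
  (trans (rename-sub (lift ρ) (lifts σ) _ t)
         (sub-cong t (lift-lifts ρ σ) (λ {x} _ → rename-lift-suc ρ (θ x))))
rename-sub ρ σ θ (t · u)   = cong₂ _·_ (rename-sub ρ σ θ t) (rename-sub ρ σ θ u)

sub-lifts-suc : (σ : Fin m → Term n) (θ : Name → Term n) (t : Term m) →
  sub (lifts σ) (rename suc ∘ θ) (rename suc t) ≡ rename suc (sub σ θ t)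
sub-lifts-suc σ θ t =
  trans (sub-rename (lifts σ) (rename suc ∘ θ) suc t) (sym (rename-sub suc σ θ t))

lifts-lifts : (σ : Fin m → Term n) (θ : Name → Term n) (σ′ : Fin l → Term m) →
  ∀ i → sub (lifts σ) (rename suc ∘ θ) (lifts σ′ i) ≡ lifts (sub σ θ ∘ σ′) i
lifts-lifts σ θ σ′ zero    = refl
lifts-lifts σ θ σ′ (suc i) = sub-lifts-suc σ θ (σ′ i)

-- Since `abs`, `inst` and `[_/_]_` are all instances of `sub`, identities between them reduce to
-- this fusion law and `sub-cong`. Under a binder it needs commutation with `rename suc`, hence the
-- laws for renamings first.
sub-sub : (σ : Fin m → Term n) (θ : Name → Term n)
  (σ′ : Fin l → Term m) (θ′ : Name → Term m) (t : Term l) →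
  sub σ θ (sub σ′ θ′ t) ≡ sub (sub σ θ ∘ σ′) (sub σ θ ∘ θ′) t
sub-sub σ θ σ′ θ′ (bvar i)  = refl
sub-sub σ θ σ′ θ′ (fvar x)  = refl
sub-sub σ θ σ′ θ′ (sort s)  = refl
sub-sub σ θ σ′ θ′ (pi A B)  = cong₂ pi (sub-sub σ θ σ′ θ′ A)
  (trans (sub-sub (lifts σ) _ (lifts σ′) _ B)
         (sub-cong B (lifts-lifts σ θ σ′) (λ {x} _ → sub-lifts-suc σ θ (θ′ x))))
sub-sub σ θ σ′ θ′ (lam A t) = cong₂ lam (sub-sub σ θ σ′ θ′ A)
  (trans (sub-sub (lifts σ) _ (lifts σ′) _ t)
         (sub-cong t (lifts-lifts σ θ σ′) (λ {x} _ → sub-lifts-suc σ θ (θ′ x))))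
sub-sub σ θ σ′ θ′ (t · u)   = cong₂ _·_ (sub-sub σ θ σ′ θ′ t) (sub-sub σ θ σ′ θ′ u)

sub-id : (t : Term n) → sub bvar fvar t ≡ t
sub-id (bvar i)  = refl
sub-id (fvar x)  = refl
sub-id (sort s)  = refl
sub-id (pi A B)  = cong₂ pi (sub-id A)
  (trans (sub-cong-bvar B (λ { zero → refl ; (suc i) → refl })) (sub-id B))
sub-id (lam A t) = cong₂ lam (sub-id A)
  (trans (sub-cong-bvar t (λ { zero → refl ; (suc i) → refl })) (sub-id t))
sub-id (t · u)   = cong₂ _·_ (sub-id t) (sub-id u)

sub-fresh : {u : Term n} (t : Term n) → ¬ x ∈fv t → [ u / x ] t ≡ t
sub-fresh t x∉t =
  trans (sub-cong t (λ _ → refl) (λ y∈t → update-≢ fvar _ _ λ { refl → x∉t y∈t })) (sub-id t)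

abs-fresh : (t : Term n) → ¬ x ∈fv t → abs x t ≡ rename suc t
abs-fresh t x∉t =
  trans (sub-cong t (λ _ → refl) (λ y∈t → update-≢ fvar _ _ λ { refl → x∉t y∈t }))
        (sym (rename≡sub suc t))

inst-abs : (x : Name) (t u : Term n) → inst (abs x t) u ≡ [ u / x ] t
inst-abs x t u = trans (sub-sub _ fvar _ _ t)
  (sub-cong t (λ _ → refl)
    (λ {w} _ → update-rel (λ v v′ → sub _ fvar v ≡ v′) fvar fvar x w refl (λ _ → refl)))

-- The same product can be written with different bound names. By `inst-abs`, substituting for the
-- bound name depends only on the nameless body.
sub-abs : (x y : Name) (t t′ u : Term n) → abs x t ≡ abs y t′ → [ u / x ] t ≡ [ u / y ] t′
sub-abs x y t t′ u e =
  trans (sym (inst-abs x t u)) (trans (cong (λ s → inst s u) e) (inst-abs y t′ u))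

-- The content of the stability of `Beta` under substitution.
sub-inst : (σ : Fin m → Term n) (θ : Name → Term n) (t : Term (suc m)) (u : Term m) →
  sub σ θ (inst t u) ≡ inst (sub (lifts σ) (rename suc ∘ θ) t) (sub σ θ u)
sub-inst σ θ t u = trans (sub-sub σ θ _ fvar t)
  (trans (sub-cong t (λ { zero → refl ; (suc i) → sym (inst-rename (σ i)) })
                     (λ {x} _ → sym (inst-rename (θ x))))
         (sym (sub-sub _ fvar (lifts σ) (rename suc ∘ θ) t)))
  where
  inst-rename : ∀ t → inst (rename suc t) (sub σ θ u) ≡ t
  inst-rename t = trans (sub-rename _ fvar suc t) (sub-id t)

-- Free names

∈fv-rename⁻ : (ρ : Fin m → Fin n) (t : Term m) → x ∈fv rename ρ t → x ∈fv t
∈fv-rename⁻ ρ (fvar y)  e = e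
∈fv-rename⁻ ρ (pi A B)  (inj₁ p) = inj₁ (∈fv-rename⁻ ρ A p)
∈fv-rename⁻ ρ (pi A B)  (inj₂ p) = inj₂ (∈fv-rename⁻ (lift ρ) B p)
∈fv-rename⁻ ρ (lam A t) (inj₁ p) = inj₁ (∈fv-rename⁻ ρ A p)
∈fv-rename⁻ ρ (lam A t) (inj₂ p) = inj₂ (∈fv-rename⁻ (lift ρ) t p)
∈fv-rename⁻ ρ (t · u)   (inj₁ p) = inj₁ (∈fv-rename⁻ ρ t p)
∈fv-rename⁻ ρ (t · u)   (inj₂ p) = inj₂ (∈fv-rename⁻ ρ u p)

∈fv-sub⁻ : {σ : Fin m → Term n} {θ : Name → Term n} (t : Term m) → x ∈fv sub σ θ t →
  (∃[ i ] x ∈fv σ i) ⊎ (∃[ y ] y ∈fv t × x ∈fv θ y)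

∈fv-sub↑⁻ : {σ : Fin m → Term n} {θ : Name → Term n} (t : Term (suc m)) →
  x ∈fv sub (lifts σ) (rename suc ∘ θ) t →
  (∃[ i ] x ∈fv σ i) ⊎ (∃[ y ] y ∈fv t × x ∈fv θ y)
∈fv-sub↑⁻ {σ = σ} {θ} t p with ∈fv-sub⁻ t p
... | inj₁ (suc i , q) = inj₁ (i , ∈fv-rename⁻ suc (σ i) q)
... | inj₂ (y , q , r) = inj₂ (y , q , ∈fv-rename⁻ suc (θ y) r)

widen : ∀ {a p} {A : Set a} {P Q : Name → Set} {R : Name → Set p} →
  (∀ {y} → P y → Q y) → A ⊎ (∃[ y ] P y × R y) → A ⊎ (∃[ y ] Q y × R y)
widen f (inj₁ a)           = inj₁ a
widen f (inj₂ (y , p , r)) = inj₂ (y , f p , r)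

∈fv-sub⁻ (bvar i)  p = inj₁ (i , p)
∈fv-sub⁻ (fvar y)  p = inj₂ (y , refl , p)
∈fv-sub⁻ (pi A B)  (inj₁ p) = widen inj₁ (∈fv-sub⁻ A p)
∈fv-sub⁻ (pi A B)  (inj₂ p) = widen inj₂ (∈fv-sub↑⁻ B p)
∈fv-sub⁻ (lam A t) (inj₁ p) = widen inj₁ (∈fv-sub⁻ A p)
∈fv-sub⁻ (lam A t) (inj₂ p) = widen inj₂ (∈fv-sub↑⁻ t p)
∈fv-sub⁻ (t · u)   (inj₁ p) = widen inj₁ (∈fv-sub⁻ t p)
∈fv-sub⁻ (t · u)   (inj₂ p) = widen inj₂ (∈fv-sub⁻ u p)

∈fv-abs⁻ : (t : Term n) → x ∈fv abs y t → x ∈fv t × x ≢ y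
∈fv-abs⁻ {x = x} {y} t p with ∈fv-sub⁻ t p
... | inj₂ (z , z∈t , q) =
  -- The relation ignores its second argument, so the second function and value are placeholders.
  update-rel (λ v _ → x ∈fv v → x ∈fv t × x ≢ y) fvar (fvar {1}) y {b = bvar zero} z
    (λ ()) (λ { z≢y refl → z∈t , z≢y }) q

fvs : Term n → List Name
fvs (bvar i)  = []
fvs (fvar x)  = x ∷ []
fvs (sort s)  = []
fvs (pi A B)  = fvs A ++ fvs B
fvs (lam A t) = fvs A ++ fvs t
fvs (t · u)   = fvs t ++ fvs u

∈fv⇒∈fvs : (t : Term n) → x ∈fv t → x ∈ fvs t
∈fv⇒∈fvs (fvar y)  refl = here refl
∈fv⇒∈fvs (pi A B)  = [ ∈-++⁺ˡ ∘ ∈fv⇒∈fvs A , ∈-++⁺ʳ (fvs A) ∘ ∈fv⇒∈fvs B ]′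
∈fv⇒∈fvs (lam A t) = [ ∈-++⁺ˡ ∘ ∈fv⇒∈fvs A , ∈-++⁺ʳ (fvs A) ∘ ∈fv⇒∈fvs t ]′
∈fv⇒∈fvs (t · u)   = [ ∈-++⁺ˡ ∘ ∈fv⇒∈fvs t , ∈-++⁺ʳ (fvs t) ∘ ∈fv⇒∈fvs u ]′

∃-fresh : (xs : List Name) → ∃[ x ] x ∉ xs
∃-fresh xs = suc (max 0 xs) , λ p → 1+n≰n (lookup (xs≤max 0 xs) p)

∈⇒∈dom : ∀ {Γ : Ctx} {A} → (x , A) ∈ Γ → x ∈ dom Γ
∈⇒∈dom = ∈-map⁺ proj₁

∈dom⇒∈ : ∀ {Γ : Ctx} → x ∈ dom Γ → ∃[ A ] (x , A) ∈ Γ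
∈dom⇒∈ p with ∈-map⁻ proj₁ p
... | (_ , A) , q , refl = A , q

∈dom-++⁺ˡ : ∀ {Γ Δ : Ctx} → x ∈ dom Γ → x ∈ dom (Γ ++ Δ)
∈dom-++⁺ˡ p = ∈⇒∈dom (∈-++⁺ˡ (proj₂ (∈dom⇒∈ p)))

∈dom-++⁺ʳ : ∀ (Γ : Ctx) {Δ} → x ∈ dom Δ → x ∈ dom (Γ ++ Δ)
∈dom-++⁺ʳ Γ p = ∈⇒∈dom (∈-++⁺ʳ Γ (proj₂ (∈dom⇒∈ p)))

∈dom-++⁻ : ∀ (Γ : Ctx) {Δ} → x ∈ dom (Γ ++ Δ) → x ∈ dom Γ ⊎ x ∈ dom Δ
∈dom-++⁻ Γ p = Sum.map ∈⇒∈dom ∈⇒∈dom (∈-++⁻ Γ (proj₂ (∈dom⇒∈ p)))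

-- Scoping of typing judgments, for an arbitrary signature and set of rules

module Scoping {r : Level} (Sg : Ctx) (𝓡 : Pred Rule r) where
  open Typing Sg 𝓡

  ∈fv⇒∈dom : ∀ {Γ t A} → Γ ⊢ t ∶ A → x ∈fv t → x ∈ dom (Γ ++ Sg)

  ∈fv-abs⇒∈dom : ∀ {Γ t A B} → Γ , y ∶ A ⊢ t ∶ B → x ∈fv abs y t → x ∈ dom (Γ ++ Sg)
  ∈fv-abs⇒∈dom {t = t} d p with ∈fv-abs⁻ t p
  ... | x∈t , x≢y with ∈fv⇒∈dom d x∈t
  ...   | here x≡y = ⊥-elim (x≢y x≡y)
  ...   | there q  = q

  ∈fv⇒∈dom (var _ c) refl            = ∈⇒∈dom c
  ∈fv⇒∈dom (prod _ d e) (inj₁ p)     = ∈fv⇒∈dom d p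
  ∈fv⇒∈dom (prod _ d e) (inj₂ p)     = ∈fv-abs⇒∈dom e p
  ∈fv⇒∈dom (abst _ d _ e) (inj₁ p)   = ∈fv⇒∈dom d p
  ∈fv⇒∈dom (abst _ d _ e) (inj₂ p)   = ∈fv-abs⇒∈dom e p
  ∈fv⇒∈dom (app d e) (inj₁ p)        = ∈fv⇒∈dom d p
  ∈fv⇒∈dom (app d e) (inj₂ p)        = ∈fv⇒∈dom e p
  ∈fv⇒∈dom (conv _ _ _ d _) p        = ∈fv⇒∈dom d p

  WF⇒scoped : ∀ {Γ A} → WF Γ → (y , A) ∈ Γ → x ∈fv A → x ∈ dom (Γ ++ Sg)
  WF⇒scoped (declare s d _) (here refl) p = there (∈fv⇒∈dom d p)
  WF⇒scoped (declare s d _) (there q)   p = there (WF⇒scoped (wf d) q p)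

-- Substitution lemma

⟨_⟩ : (Name → Term 0) → Term 0 → Term 0
⟨_⟩ = sub bvar

-- The target theory may differ from the source, so that the embedding of the
-- plain calculus, in which constants are typed, is an instance.
module Transfer {r₁ r₂ : Level} (S : Ctx) (𝓢 : Pred Rule r₁) (Sg : Ctx) (𝓡 : Pred Rule r₂)
  (𝓢⊆𝓡 : ∀ {ρ} → 𝓢 ρ → 𝓡 ρ)
  (S-scoped : ∀ {c A x} → (c , A) ∈ S → x ∈fv A → x ∈ dom S)
  (𝓢-scoped : ∀ {ρ} → 𝓢 ρ → ∀ {x} → x ∈fv Rule.l ρ ⊎ x ∈fv Rule.r ρ →
              x ∉ dom (Rule.Γ ρ) → x ∈ dom S)
  where

  private
    module Src = Typing S 𝓢
    module Tgt = Typing Sg 𝓡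

  open DecMembership _≟_ using (_∈?_)

  -- Rules may mention constants, which an instance of a rule leaves alone; a substitution that
  -- moved them would not preserve rewrite steps.
  Fixes : (Name → Term n) → Set
  Fixes θ = ∀ {c} → c ∈ dom S → θ c ≡ fvar c

  fixes↑ : {θ : Name → Term n} → Fixes θ → Fixes (rename suc ∘ θ)
  fixes↑ fix p = cong (rename suc) (fix p)

  module _ {σ : Fin m → Term n} {θ : Name → Term n} (fix : Fixes θ) where

    root-sub : ∀ {t u} → BetaRoot 𝓢 t u → BetaRoot 𝓡 (sub σ θ t) (sub σ θ u)
    root-sub (inj₁ (β {A} {t} {u})) =
      inj₁ (subst (Beta _) (sym (sub-inst σ θ t u)) β)
    root-sub (inj₂ (rule {ρ} ρ∈𝓢 η η-id)) =
      inj₂ (subst₂ (Root 𝓡) (sym (composite (Rule.l ρ) (𝓢-scoped ρ∈𝓢 ∘ inj₁)))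
                            (sym (composite (Rule.r ρ) (𝓢-scoped ρ∈𝓢 ∘ inj₂)))
                   (rule (𝓢⊆𝓡 ρ∈𝓢) η′ η′-∉))
      where
      open Rule ρ using (Γ)

      -- The composite of `η` with `sub σ θ` may move names outside `Γ`, which `rule` forbids, so it
      -- is cut off there. On both sides of the rule this changes nothing: their other names are
      -- constants, which `θ` fixes.
      η′ : Name → Term n
      η′ x = if does (x ∈? dom Γ) then sub σ θ (η x) else fvar x

      η′-∈ : x ∈ dom Γ → η′ x ≡ sub σ θ (η x)
      η′-∈ {x} p = cong (if_then sub σ θ (η x) else fvar x) (dec-true (x ∈? dom Γ) p)

      η′-∉ : x ∉ dom Γ → η′ x ≡ fvar x
      η′-∉ {x} p = cong (if_then sub σ θ (η x) else fvar x) (dec-false (x ∈? dom Γ) p)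

      composite : (t : Term 0) → (∀ {x} → x ∈fv t → x ∉ dom Γ → x ∈ dom S) →
        sub σ θ (sub (λ ()) η t) ≡ sub (λ ()) η′ t
      composite t scoped = trans (sub-sub σ θ (λ ()) η t) (sub-cong t (λ ()) agree)
        where
        agree : ∀ {x} → x ∈fv t → sub σ θ (η x) ≡ η′ x
        agree {x} x∈t = [ sym ∘ η′-∈ , outside ]′ (toSum (x ∈? dom Γ))
          where
          outside : x ∉ dom Γ → sub σ θ (η x) ≡ η′ x
          outside x∉Γ = trans (cong (sub σ θ) (η-id x∉Γ))
            (trans (fix (scoped x∈t x∉Γ)) (sym (η′-∉ x∉Γ)))

  closure-sub : {σ : Fin m → Term n} {θ : Name → Term n} → Fixes θ → ∀ {t u} →
    Closure (BetaRoot 𝓢) t u → Closure (BetaRoot 𝓡) (sub σ θ t) (sub σ θ u)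
  closure-sub fix (root p) = root (root-sub fix p)
  closure-sub fix (piˡ p)  = piˡ (closure-sub fix p)
  closure-sub fix (piʳ p)  = piʳ (closure-sub (fixes↑ fix) p)
  closure-sub fix (lamˡ p) = lamˡ (closure-sub fix p)
  closure-sub fix (lamʳ p) = lamʳ (closure-sub (fixes↑ fix) p)
  closure-sub fix (appˡ p) = appˡ (closure-sub fix p)
  closure-sub fix (appʳ p) = appʳ (closure-sub fix p)

  scoped : ∀ {Γ A} → Src.WF Γ → (y , A) ∈ Γ ++ S → x ∈fv A → x ∈ dom (Γ ++ S)
  scoped {Γ = Γ} w p x∈A with ∈-++⁻ Γ p
  ... | inj₁ q = Scoping.WF⇒scoped S 𝓢 w q x∈A
  ... | inj₂ q = ∈dom-++⁺ʳ Γ (S-scoped q x∈A)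

  -- 𝒫 is first "being a declared variable", which yields weakening, and then
  -- typability, whose preservation under binders needs weakening.
  module Simultaneous {p : Level} (𝒫 : Ctx → Term 0 → Term 0 → Set p)
    (𝒫⇒⊢ : ∀ {Δ t A} → Tgt.WF Δ → 𝒫 Δ t A → Δ Tgt.⊢ t ∶ A)
    (𝒫-weaken : ∀ {Δ y C t A} → Tgt.WF (Δ , y ∶ C) → 𝒫 Δ t A → 𝒫 (Δ , y ∶ C) t A)
    (𝒫-var : ∀ {Δ y C} → Tgt.WF (Δ , y ∶ C) → 𝒫 (Δ , y ∶ C) (fvar y) C)
    where

    record Maps (Γ : Ctx) (θ : Name → Term 0) (Δ : Ctx) : Set p where
      field
        fixes  : Fixes θ
        images : ∀ {x A} → (x , A) ∈ Γ ++ S → 𝒫 Δ (θ x) (⟨ θ ⟩ A)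

    open Maps

    -- Under a binder, the source name `x` is sent to a target name `y` of its own. Neither `A` nor
    -- the earlier types mention `x`, so updating `θ` at `x` does not affect their images.
    maps-extend : ∀ {Γ Δ θ x y A} → Src.WF (Γ , x ∶ A) → Tgt.WF (Δ , y ∶ ⟨ θ ⟩ A) →
      Maps Γ θ Δ → Maps (Γ , x ∶ A) (update θ x (fvar y)) (Δ , y ∶ ⟨ θ ⟩ A)
    maps-extend {Γ} {Δ} {θ} {x} {y} {A} (Src.declare s d x∉Γ) w′ θ-maps = record
      { fixes  = λ c∈S → trans (update-≢ θ x (fvar y) λ { refl → x∉Γ (∈dom-++⁺ʳ Γ c∈S) }) (fixes θ-maps c∈S)
      ; images = λ where
          (here refl) → subst₂ (𝒫 (Δ , y ∶ ⟨ θ ⟩ A)) (sym (update-≡ θ x (fvar y)))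
            (sym (same (Scoping.∈fv⇒∈dom S 𝓢 d))) (𝒫-var w′)
          (there z∈Γ) → subst₂ (𝒫 (Δ , y ∶ ⟨ θ ⟩ A))
            (sym (update-≢ θ x (fvar y) λ { refl → x∉Γ (∈⇒∈dom z∈Γ) }))
            (sym (same (scoped (Src.wf d) z∈Γ))) (𝒫-weaken w′ (images θ-maps z∈Γ))
      }
      where
      same : ∀ {C} → (∀ {z} → z ∈fv C → z ∈ dom (Γ ++ S)) →
        ⟨ update θ x (fvar y) ⟩ C ≡ ⟨ θ ⟩ C
      same {C} C-scoped =
        sub-cong C (λ ()) (λ z∈C → update-≢ θ x (fvar y) λ { refl → x∉Γ (C-scoped z∈C) })

    fresh : ∀ Δ (θ : Name → Term 0) (t : Term 0) →
      ∃[ y ] y ∉ dom (Δ ++ Sg) × (∀ {z} → z ∈fv t → ¬ y ∈fv θ z)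
    fresh Δ θ t =
      let y , y∉ = ∃-fresh (dom (Δ ++ Sg) ++ concatMap (fvs ∘ θ) (fvs t)) in
      y , y∉ ∘ ∈-++⁺ˡ ,
      λ {z} z∈t y∈ → y∉ (∈-++⁺ʳ (dom (Δ ++ Sg))
        (∈-concatMap⁺ (fvs ∘ θ) (lose (∈fv⇒∈fvs t z∈t) (∈fv⇒∈fvs (θ z) y∈))))

    module _ {θ : Name → Term 0} {x y : Name} where

      -- The right-hand side is what `⟨ θ ⟩` makes of a binder body. It is recovered by substituting
      -- with the bound name sent to `y` and abstracting `y` again; no capture occurs, as `y` is
      -- free in no image under `θ` of a free name of `t`.
      abs-update : ∀ t → (∀ {z} → z ∈fv t → ¬ y ∈fv θ z) →
        abs y (⟨ update θ x (fvar y) ⟩ t) ≡ sub (lifts bvar) (rename suc ∘ θ) (abs x t)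
      abs-update t y∉ = begin
        abs y (⟨ θ′ ⟩ t)                             ≡⟨ sub-sub _ _ _ _ t ⟩
        sub _ (abs y ∘ θ′) t                         ≡⟨ sub-cong t (λ ()) (λ {z} → pointwise z) ⟩
        sub _ (θ↑ ∘ (x ↦ bvar zero)) t               ≡⟨ sub-sub _ _ _ _ t ⟨
        θ↑ (abs x t)                                 ∎
        where
        open ≡-Reasoning
        θ′ = update θ x (fvar y)
        θ↑ = sub (lifts bvar) (rename suc ∘ θ)

        pointwise : ∀ z → z ∈fv t → abs y (θ′ z) ≡ θ↑ ((x ↦ bvar zero) z)
        pointwise z z∈t = update-rel (λ v v′ → abs y v ≡ θ↑ v′) θ fvar x z
          (update-≡ fvar y (bvar zero)) (λ _ → abs-fresh (θ z) (y∉ z∈t))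

      -- The counterpart of `abs-update` for the type of an application.
      sub-update : ∀ t u → (∀ {z} → z ∈fv t → ¬ y ∈fv θ z) →
        [ ⟨ θ ⟩ u / y ] ⟨ update θ x (fvar y) ⟩ t ≡ ⟨ θ ⟩ ([ u / x ] t)
      sub-update t u y∉ = begin
        [ ⟨ θ ⟩ u / y ] ⟨ θ′ ⟩ t                      ≡⟨ sub-sub _ _ _ _ t ⟩
        sub _ ([ ⟨ θ ⟩ u / y ]_ ∘ θ′) t               ≡⟨ sub-cong t (λ ()) (λ {z} → pointwise z) ⟩
        sub _ (⟨ θ ⟩ ∘ (x ↦ u)) t                    ≡⟨ sub-sub _ _ _ _ t ⟨
        ⟨ θ ⟩ ([ u / x ] t)                          ∎
        where
        open ≡-Reasoning
        θ′ = update θ x (fvar y)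

        pointwise : ∀ z → z ∈fv t → [ ⟨ θ ⟩ u / y ] θ′ z ≡ ⟨ θ ⟩ ((x ↦ u) z)
        pointwise z z∈t = update-rel (λ v v′ → [ ⟨ θ ⟩ u / y ] v ≡ ⟨ θ ⟩ v′) θ fvar x z
          (update-≡ fvar y (⟨ θ ⟩ u)) (λ _ → sub-fresh (θ z) (y∉ z∈t))

    transfer : ∀ {Γ Δ θ t A} → Maps Γ θ Δ → Tgt.WF Δ → Γ Src.⊢ t ∶ A →
      Δ Tgt.⊢ ⟨ θ ⟩ t ∶ ⟨ θ ⟩ A
    transfer θ-maps w (Src.srt _)   = Tgt.srt w
    transfer θ-maps w (Src.var _ c) = 𝒫⇒⊢ w (images θ-maps c)
    transfer {Δ = Δ} {θ} θ-maps w (Src.prod {x} {A} {B} s dA dB) =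
      let y , y∉Δ , y∉θ = fresh Δ θ B
          dA′ = transfer θ-maps w dA
          w′  = Tgt.declare type dA′ y∉Δ
      in subst (λ B′ → Δ Tgt.⊢ pi (⟨ θ ⟩ A) B′ ∶ sort s) (abs-update B y∉θ)
           (Tgt.prod s dA′ (transfer (maps-extend (Src.wf dB) w′ θ-maps) w′ dB))
    transfer {Δ = Δ} {θ} θ-maps w (Src.abst {x} {A} {B} {t} s dA dB dt) =
      -- One name must suit both the body and its type; `t · B` merely collects their free names.
      let y , y∉Δ , y∉θ = fresh Δ θ (t · B)
          dA′ = transfer θ-maps w dA
          w′  = Tgt.declare type dA′ y∉Δ
          θ′-maps = maps-extend (Src.wf dB) w′ θ-maps
      in subst₂ (λ t′ B′ → Δ Tgt.⊢ lam (⟨ θ ⟩ A) t′ ∶ pi (⟨ θ ⟩ A) B′)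
           (abs-update t (y∉θ ∘ inj₁)) (abs-update B (y∉θ ∘ inj₂))
           (Tgt.abst s dA′ (transfer θ′-maps w′ dB) (transfer θ′-maps w′ dt))
    transfer {Δ = Δ} {θ} θ-maps w (Src.app {x} {A} {B} {t} {u} dt du) =
      let y , y∉Δ , y∉θ = fresh Δ θ B
          -- The induction hypothesis gives a product with a nameless body, which must be written
          -- with a bound name again before `app` applies.
          dt′ = subst (λ B′ → Δ Tgt.⊢ ⟨ θ ⟩ t ∶ pi (⟨ θ ⟩ A) B′)
                  (sym (abs-update B y∉θ)) (transfer θ-maps w dt)
      in subst (Δ Tgt.⊢ ⟨ θ ⟩ (t · u) ∶_) (sub-update B u y∉θ)
           (Tgt.app {x = y} {B = ⟨ update θ x (fvar y) ⟩ B} dt′ (transfer θ-maps w du))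
    transfer θ-maps w (Src.conv s dA dB dt e) =
      Tgt.conv s (transfer θ-maps w dA) (transfer θ-maps w dB) (transfer θ-maps w dt)
        (gmap _ (closure-sub (fixes θ-maps)) e)

  Declared : Ctx → Term 0 → Term 0 → Set
  Declared Δ t A = ∃[ x ] t ≡ fvar x × (x , A) ∈ Δ ++ Sg

  declared⇒⊢ : ∀ {Δ t A} → Tgt.WF Δ → Declared Δ t A → Δ Tgt.⊢ t ∶ A
  declared⇒⊢ w (x , refl , x∈) = Tgt.var w x∈

  declared-weaken : ∀ {Δ y C t A} → Tgt.WF (Δ , y ∶ C) → Declared Δ t A → Declared (Δ , y ∶ C) t A
  declared-weaken _ (x , t≡x , x∈) = x , t≡x , there x∈

  declared-var : ∀ {Δ y C} → Tgt.WF (Δ , y ∶ C) → Declared (Δ , y ∶ C) (fvar y) C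
  declared-var _ = _ , refl , here refl

  open Simultaneous Declared declared⇒⊢ declared-weaken declared-var

  -- A plain induction would fail at binders, since a name bound in the derivation may already be
  -- declared in `Δ`. Transferring along the identity substitution rechooses these names.
  embed : ∀ {Γ Δ t A} → (∀ {x C} → (x , C) ∈ Γ ++ S → (x , C) ∈ Δ ++ Sg) → Tgt.WF Δ →
    Γ Src.⊢ t ∶ A → Δ Tgt.⊢ t ∶ A
  embed {t = t} {A} Γ⊆Δ w d = subst₂ (_ Tgt.⊢_∶_) (sub-id t) (sub-id A) $
    transfer (record { fixes  = λ _ → refl
                     ; images = λ {_} {C} p → _ , refl ,
                         subst (λ C′ → (_ , C′) ∈ _) (sym (sub-id C)) (Γ⊆Δ p) }) w d

-- Weakening, substitution and type correctness for a theory

module TypeCorrectness {r : Level} (T : Theory r) where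
  open Theory T

  Sg-scoped : ∀ {c A} → (c , A) ∈ Sg → x ∈fv A → x ∈ dom Sg
  Sg-scoped c∈Sg x∈A =
    [ id , (λ ()) ]′ (∈dom-++⁻ Sg (Scoping.WF⇒scoped [] ∅ Sg-wf c∈Sg x∈A))

  𝓡-scoped : ∀ {ρ} → 𝓡 ρ → ∀ {x} → x ∈fv Rule.l ρ ⊎ x ∈fv Rule.r ρ →
    x ∉ dom (Rule.Γ ρ) → x ∈ dom Sg
  𝓡-scoped {ρ} ρ∈𝓡 x∈lr x∉Γ with 𝓡-wellTyped ρ∈𝓡
  ... | _ , _ , dl , dr =
    [ (λ p → [ ⊥-elim ∘ x∉Γ , id ]′ (∈dom-++⁻ (Rule.Γ ρ) p)) , (λ ()) ]′
      (∈dom-++⁻ (Rule.Γ ρ ++ Sg)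
        ([ Scoping.∈fv⇒∈dom [] ∅ dl , Scoping.∈fv⇒∈dom [] ∅ dr ]′ x∈lr))

  private
    module λΠ-to-T = Transfer [] ∅ Sg 𝓡 (λ ()) (λ ()) (λ ())
    module T-to-T  = Transfer Sg 𝓡 Sg 𝓡 id Sg-scoped 𝓡-scoped

  weaken : ∀ {Γ y C t A} → WF (Γ , y ∶ C) → Γ ⊢ t ∶ A → Γ , y ∶ C ⊢ t ∶ A
  weaken = T-to-T.embed there

  last-var : ∀ {Γ y C} → WF (Γ , y ∶ C) → Γ , y ∶ C ⊢ fvar y ∶ C
  last-var w = var w (here refl)

  open T-to-T.Simultaneous _⊢_∶_ (λ _ d → d) weaken last-var

  -- The substitution sends `x` to `u` and every other name to itself. Well-formedness makes `x`
  -- fresh for `Γ` and `Sg`, so the types declared there, and `A`, are left unchanged.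
  substitution : ∀ {Γ x A t B u} → Γ , x ∶ A ⊢ t ∶ B → Γ ⊢ u ∶ A →
    Γ ⊢ [ u / x ] t ∶ [ u / x ] B
  substitution {Γ} {x} {A} {u = u} dt du with wf dt
  ... | w@(declare s dA x∉Γ) = transfer maps (wf du) dt
    where
    fix : ∀ {C} → (∀ {z} → z ∈fv C → z ∈ dom (Γ ++ Sg)) → [ u / x ] C ≡ C
    fix {C} C-scoped = sub-fresh C (x∉Γ ∘ C-scoped)

    maps : Maps (Γ , x ∶ A) (x ↦ u) Γ
    maps = record
      { fixes  = λ c∈Sg → update-≢ fvar x u λ { refl → x∉Γ (∈dom-++⁺ʳ Γ c∈Sg) }
      ; images = λ where
          (here refl) → subst₂ (Γ ⊢_∶_) (sym (update-≡ fvar x u))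
            (sym (fix (Scoping.∈fv⇒∈dom Sg 𝓡 dA))) du
          (there z∈Γ) → subst₂ (Γ ⊢_∶_)
            (sym (update-≢ fvar x u λ { refl → x∉Γ (∈⇒∈dom z∈Γ) }))
            (sym (fix (T-to-T.scoped (wf dA) z∈Γ))) (var (wf du) z∈Γ)
      }

  declared-type : ∀ {Γ A} → WF Γ → (x , A) ∈ Γ → ∃[ s ] Γ ⊢ A ∶ sort s
  declared-type w@(declare s d _) (here refl) = s , weaken w d
  declared-type w@(declare _ d _) (there x∈Γ) =
    let s , d′ = declared-type (wf d) x∈Γ in s , weaken w d′

  -- The type of a constant is typed in the plain calculus, where the earlier constants form an
  -- ordinary context; `embed` moves that derivation to the theory. The recursion `go` runs through
  -- the initial segments of `Sg`.
  constant-type : ∀ {Γ c A} → WF Γ → (c , A) ∈ Sg → ∃[ s ] Γ ⊢ A ∶ sort s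
  constant-type {Γ} w = go Sg-wf (∈-++⁺ʳ Γ)
    where
    go : ∀ {Δ c A} → λΠ.WF Δ → (∀ {x C} → (x , C) ∈ Δ → (x , C) ∈ Γ ++ Sg) →
      (c , A) ∈ Δ → ∃[ s ] Γ ⊢ A ∶ sort s
    go {Δ , _ ∶ _} (λΠ.declare s d _) Δ⊆ (here refl) = s , λΠ-to-T.embed Δ++[]⊆ w d
      where
      Δ++[]⊆ : ∀ {x C} → (x , C) ∈ Δ ++ [] → (x , C) ∈ Γ ++ Sg
      Δ++[]⊆ p = [ Δ⊆ ∘ there , (λ ()) ]′ (∈-++⁻ Δ p)
    go (λΠ.declare s d _) Δ⊆ (there c∈Δ) = go (λΠ.wf d) (Δ⊆ ∘ there) c∈Δ

  -- The bound name of a product is not determined by the term, so inversion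
  -- yields a name that is fresh for Γ, whichever one was used to write it.
  prod-inversion : ∀ {Γ A B₀ C} → Γ ⊢ pi A B₀ ∶ C →
    ∃[ y ] ∃[ B ] ∃[ s ] Γ ⊢ A ∶ Type × Γ , y ∶ A ⊢ B ∶ sort s × B₀ ≡ abs y B
  prod-inversion (prod s dA dB)    = _ , _ , s , dA , dB , refl
  prod-inversion (conv _ _ _ d _)  = prod-inversion d

  -- Application is the case with content: the product type of the function is itself typed,
  -- inversion types its codomain, and `substitution` inserts the argument.
  type-correctness : ∀ {Γ t B} → Γ ⊢ t ∶ B → B ≡ Kind ⊎ (∃[ s ] Γ ⊢ B ∶ sort s)

  domain-codomain : ∀ {Γ t A} x B → Γ ⊢ t ∶ Π[ x ∶ A ] B →
    ∃[ y ] ∃[ B′ ] ∃[ s ] Γ ⊢ A ∶ Type × Γ , y ∶ A ⊢ B′ ∶ sort s × abs x B ≡ abs y B′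
  domain-codomain x B d with type-correctness d
  -- The other alternative is absurd, as a product is not `Kind`.
  ... | inj₂ (_ , dΠ) = prod-inversion dΠ

  type-correctness (srt _) = inj₁ refl
  type-correctness {Γ} (var w x∈) =
    inj₂ ([ declared-type w , constant-type w ]′ (∈-++⁻ Γ x∈))
  type-correctness (prod kind _ _)   = inj₁ refl
  type-correctness (prod type dA _)  = inj₂ (kind , srt (wf dA))
  type-correctness (abst s dA dB _)  = inj₂ (s , prod s dA dB)
  type-correctness {Γ} (app {x} {A} {B} {t} {u} dt du) with domain-codomain x B dt
  ... | y , B′ , s , dA , dB′ , e =
    inj₂ (s , subst (λ C → Γ ⊢ C ∶ sort s) (sym (sub-abs x y B B′ u e)) (substitution dB′ du))
  type-correctness (conv s _ dB _ _) = inj₂ (s , dB)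

-- Valuations

module _ {ℓ : Level} where

  ∈-respˡ-≈ : {v w : V ℓ} {a : V ℓ} → v ≈ w → v ∈ᵛ a → w ∈ᵛ a
  ∈-respˡ-≈ {a = sup I f} v≈w (i , e) = i , ≈-trans (≈-sym v≈w) e

  at-≔-≡ : (φ : Vec (Valuation ℓ) k) (x : Name) (c : Vec (V ℓ) k) → at x (φ , x ≔ c) ≡ c
  at-≔-≡ []      x []       = refl
  at-≔-≡ (ψ ∷ φ) x (c ∷ cs) = cong₂ _∷_ (update-≡ ψ x c) (at-≔-≡ φ x cs)

  at-≔-≢ : (φ : Vec (Valuation ℓ) k) (x : Name) (c : Vec (V ℓ) k) → y ≢ x →
    at y (φ , x ≔ c) ≡ at y φ
  at-≔-≢ []      x []       y≢x = refl
  at-≔-≢ (ψ ∷ φ) x (c ∷ cs) y≢x = cong₂ _∷_ (update-≢ ψ x c y≢x) (at-≔-≢ φ x cs y≢x)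

  Agree : Vec (Valuation ℓ) k → Vec (Valuation ℓ) k → Ctx → Set (Level.suc ℓ)
  Agree φ ψ Γ = ∀ {x} → x ∈ dom Γ → Pointwise _≈_ (at x φ) (at x ψ)

  agree-refl : (φ : Vec (Valuation ℓ) k) → ∀ Γ → Agree φ φ Γ
  agree-refl φ Γ _ = Pointwise.refl ≈-refl

  agree-≔ : (φ : Vec (Valuation ℓ) k) (x : Name) (c : Vec (V ℓ) k) → ∀ Γ → x ∉ dom Γ →
    Agree φ (φ , x ≔ c) Γ
  agree-≔ φ x c Γ x∉Γ {y} y∈Γ = subst (Pointwise _≈_ (at y φ))
    (sym (at-≔-≢ φ x c λ { refl → x∉Γ y∈Γ })) (Pointwise.refl ≈-refl)

-- Invariance and extension of valuations in a model

module ModelProperties {r ℓ : Level} {T : Theory r} {m : ℕ} (M : Model T m ℓ) where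
  open Theory T
  open Model M

  -- Each component is constrained by an interpretation of `A` at the preceding valuations only, so
  -- `𝒟-local` is applied to the tails.
  elements-cong : .(p : k ≤ 2 + m) → ∀ {Γ A C} {φ ψ : Vec (Valuation ℓ) k} {c d} →
    Γ ⊢ A ∶ C → Valuates p Γ φ → Valuates p Γ ψ → Agree φ ψ Γ →
    Pointwise _≈_ c d → Elements p A φ c → Elements p A ψ d
  elements-cong p {φ = []} {[]} dA v v′ φ~ψ [] _ = _
  elements-cong p {φ = _ ∷ _} {_ ∷ _} dA v v′ φ~ψ (c≈d ∷ cs≈ds) (c∈ , cs∈) =
    ∈-respʳ-≈ (𝒟-local p (typed dA) (typed dA) (λ q → proj₂ (v q)) (λ q → proj₂ (v′ q))
                (λ _ q → Pointwise.tail (φ~ψ q)))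
              (∈-respˡ-≈ c≈d c∈) ,
    elements-cong (<⇒≤ p) dA (λ q → proj₂ (v q)) (λ q → proj₂ (v′ q))
      (λ q → Pointwise.tail (φ~ψ q)) cs≈ds cs∈

  -- Induction on well-formedness: the interpretations of a declared type under `φ` and `ψ` can be
  -- compared only once `ψ` is known to valuate the context before that declaration.
  valuates-cong : .(p : k ≤ 2 + m) → ∀ {Γ} {φ ψ : Vec (Valuation ℓ) k} → WF Γ →
    Agree φ ψ Γ → Valuates p Γ φ → Valuates p Γ ψ
  valuates-cong p empty φ~ψ v ()
  valuates-cong p {φ = φ} {ψ} (declare s d _) φ~ψ v (here refl) =
    elements-cong p {φ = φ} {ψ} d (λ q → v (there q))
      (valuates-cong p {φ = φ} {ψ} (wf d) (λ q → φ~ψ (there q)) (λ q → v (there q)))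
      (λ q → φ~ψ (there q)) (φ~ψ (here refl)) (v (here refl))
  valuates-cong p {φ = φ} {ψ} (declare s d _) φ~ψ v (there x∈Γ) =
    valuates-cong p {φ = φ} {ψ} (wf d) (λ q → φ~ψ (there q)) (λ q → v (there q)) x∈Γ

  values-elements : .(p : k < 2 + m) → ∀ {Γ u A} (φ : Vec (Valuation ℓ) k) →
    Γ ⊢ u ∶ A → Valuates (<⇒≤ p) Γ φ → Elements (<⇒≤ p) A φ (values p u φ)
  values-elements p []      d v = _
  values-elements p (ψ ∷ φ) d v =
    𝒟-member p d v , values-elements (<⇒≤ p) φ d (λ q → proj₂ (v q))

  ⊨-cong : ∀ {Γ φ ψ} → WF Γ → Agree φ ψ Γ → φ ⊨ Γ → ψ ⊨ Γ
  ⊨-cong {φ = φ} {ψ} = valuates-cong (<⇒≤ (n<1+n (suc m))) {φ = φ} {ψ}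

  ⊨-extend : ∀ {Γ x A φ c} → WF (Γ , x ∶ A) → φ ⊨ Γ →
    Elements (<⇒≤ (n<1+n (suc m))) A φ c → (φ , x ≔ c) ⊨ (Γ , x ∶ A)
  ⊨-extend {Γ} {x} {A} {φ} {c} (declare s d x∉Γ) v c∈A = λ where
      (here refl) → elements-cong (<⇒≤ (n<1+n (suc m))) d v v′ φ~φ′
        (subst (Pointwise _≈_ c) (sym (at-≔-≡ φ x c)) (Pointwise.refl ≈-refl)) c∈A
      (there y∈Γ) → v′ y∈Γ
    where
    φ~φ′ : Agree φ (φ , x ≔ c) Γ
    φ~φ′ = agree-≔ φ x c Γ (x∉Γ ∘ ∈dom-++⁺ˡ)

    v′ : (φ , x ≔ c) ⊨ Γ
    v′ = ⊨-cong {φ = φ} {φ , x ≔ c} (wf d) φ~φ′ v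

  ⟦⟧-cong : ∀ {Γ A C φ ψ} → Γ ⊢ A ∶ C → φ ⊨ Γ → ψ ⊨ Γ → Agree φ ψ Γ → ⟦ A ⟧ φ ≈ ⟦ A ⟧ ψ
  ⟦⟧-cong d v v′ φ~ψ = 𝒟-local _ (typed d) (typed d) v v′ (λ _ → φ~ψ)

-- Soundness of typing in the algebra

module Soundness {r ℓ o a : Level} {T : Theory r} {m : ℕ} {M : Model T m ℓ} {𝓑 : V ℓ}
  {alg : ΠAlgebra (El 𝓑) o (Level.suc ℓ) a} {val : ValuedIn M 𝓑 alg}
  (isModel : IsModel val) where
  open Theory T
  open TypeCorrectness T
  open Model M
  open ModelProperties M
  open ValuedIn val
  open IsModel isModel
  open ΠAlgebra alg
  open IsPreorder isPreorder using (≲-respˡ-≈; ≲-respʳ-≈) renaming (refl to ≤̃-refl; trans to ≤̃-trans)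

  private
    B̃ : Set (Level.suc ℓ)
    B̃ = Setoid.Carrier (El 𝓑)

  -- Equality in `El 𝓑` ignores the proofs of membership in `𝓑`, so an inequality can be moved from
  -- one proof to another.
  ≤̃⇒≤⟦⟧ : {b c : B̃} → ∀ {A φ} → proj₁ c ≈ ⟦ A ⟧ φ → b ≤̃ c → b ≤⟦ A ⟧ φ
  ≤̃⇒≤⟦⟧ {b} {c} e b≤c = ∈-respˡ-≈ e (proj₂ c) , ≲-respʳ-≈ e b≤c

  ≤⟦⟧⇒≤̃ : {b c : B̃} → ∀ {A φ} → ⟦ A ⟧ φ ≈ proj₁ c → b ≤⟦ A ⟧ φ → b ≤̃ c
  ≤⟦⟧⇒≤̃ e (_ , b≤A) = ≲-respʳ-≈ e b≤A

  ≤⟦⟧-trans : {b c : B̃} → ∀ {A φ} → b ≤̃ c → c ≤⟦ A ⟧ φ → b ≤⟦ A ⟧ φ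
  ≤⟦⟧-trans b≤c (A∈𝓑 , c≤A) = A∈𝓑 , ≤̃-trans b≤c c≤A

  ≤⟦sort⟧ : (b : B̃) → ∀ {Γ φ} s → WF Γ → φ ⊨ Γ → b ≤⟦ sort s ⟧ φ
  ≤⟦sort⟧ b s w v = ≤̃⇒≤⟦⟧ (≈-sym (⟦sort⟧ s w v)) (⊤̃-maximum b)

  x∧y≤x : (b c : B̃) → b ∧̃ c ≤̃ b
  x∧y≤x b c = proj₁ (∧̃-infimum b c)

  x∧y≤y : (b c : B̃) → b ∧̃ c ≤̃ c
  x∧y≤y b c = proj₁ (proj₂ (∧̃-infimum b c))

  -- The meet is computed from a derivation of well-formedness, and the premises of one typing rule
  -- may carry different ones; hence the derivation varies along with the valuations.
  ⋀-cong : ∀ {Γ φ ψ} (w w′ : WF Γ) (v : φ ⊨ Γ) (v′ : ψ ⊨ Γ) → Agree φ ψ Γ →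
    proj₁ (⋀ {φ = φ} w v) ≈ proj₁ (⋀ {φ = ψ} w′ v′)
  ⋀-cong empty empty v v′ φ~ψ = ≈-refl
  ⋀-cong {φ = φ} {ψ} (declare s d _) (declare s′ d′ _) v v′ φ~ψ = ∧̃-cong
    (⋀-cong {φ = φ} {ψ} (wf d) (wf d′) (λ q → v (there q)) (λ q → v′ (there q))
      (λ q → φ~ψ (there q)))
    (⟦⟧-cong d (λ q → v (there q)) (λ q → v′ (there q)) (λ q → φ~ψ (there q)))

  ⋀-irrelevant : ∀ {Γ φ} (w w′ : WF Γ) (v : φ ⊨ Γ) → proj₁ (⋀ {φ = φ} w v) ≈ proj₁ (⋀ {φ = φ} w′ v)
  ⋀-irrelevant {Γ} {φ} w w′ v = ⋀-cong {φ = φ} {φ} w w′ v v (agree-refl φ Γ)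

  -- Freshness of `x` makes the value independent of `c`. It brings the induction hypothesis for the
  -- body of an abstraction into the form required by `Π̃-adjoint`.
  ⋀-extend : ∀ {Γ x A C φ c} (w : WF (Γ , x ∶ A)) (d : Γ ⊢ A ∶ C) (v : φ ⊨ Γ)
    (v′ : (φ , x ≔ c) ⊨ (Γ , x ∶ A)) (A∈𝓑 : ⟦ A ⟧ φ ∈ᵛ 𝓑) →
    proj₁ (⋀ {φ = φ , x ≔ c} w v′) ≈ proj₁ (⋀ {φ = φ} (wf d) v ∧̃ (⟦ A ⟧ φ , A∈𝓑))
  ⋀-extend {Γ} {x} {φ = φ} {c} (declare s d′ x∉Γ) d v v′ _ = ∧̃-cong
    (≈-sym (⋀-cong {φ = φ} {φ , x ≔ c} (wf d) (wf d′) v (λ q → v′ (there q)) φ~φ′))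
    (≈-sym (⟦⟧-cong d v (λ q → v′ (there q)) φ~φ′))
    where
    φ~φ′ : Agree φ (φ , x ≔ c) Γ
    φ~φ′ = agree-≔ φ x c Γ (x∉Γ ∘ ∈dom-++⁺ˡ)

  ⋀≤⟦declared⟧ : ∀ {Γ φ x A} (w : WF Γ) (v : φ ⊨ Γ) → (x , A) ∈ Γ → ⋀ {φ = φ} w v ≤⟦ A ⟧ φ
  ⋀≤⟦declared⟧ {φ = φ} (declare s d _) v (here refl) = _ , x∧y≤y _ _
  ⋀≤⟦declared⟧ {φ = φ} (declare s d _) v (there x∈Γ) =
    ≤⟦⟧-trans (x∧y≤x _ _) (⋀≤⟦declared⟧ {φ = φ} (wf d) (λ q → v (there q)) x∈Γ)

  soundness : ∀ {Γ t B} (d : Γ ⊢ t ∶ B) (φ : Vec (Valuation ℓ) (suc m)) (v : φ ⊨ Γ) →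
    ⋀ {φ = φ} (wf d) v ≤⟦ B ⟧ φ
  soundness (srt w) φ v = ≤⟦sort⟧ _ kind w v
  soundness {Γ} (var w x∈) φ v with ∈-++⁻ Γ x∈
  ... | inj₁ x∈Γ  = ⋀≤⟦declared⟧ {φ = φ} w v x∈Γ
  -- Any sequence of valuations is vacuously one of the empty context, as `constants` asks.
  ... | inj₂ x∈Sg = ≤⟦⟧-trans (⊤̃-maximum _) (constants x∈Sg λ ())
  soundness (prod s dA _) φ v = ≤⟦sort⟧ _ s (wf dA) v
  soundness {Γ} (abst {x} {A} {B} s dA dB dt) φ v with ⟦Π⟧ dA dB v
  ... | S∈𝒜 , e = ≤̃⇒≤⟦⟧ (≈-sym e) (Equivalence.from (Π̃-adjoint (_ , S∈𝒜)) λ where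
    b (c , c∈A , b≈B) →
      let v′ = ⊨-extend {φ = φ} (wf dt) v c∈A in
      ≲-respˡ-≈ (⋀-extend {φ = φ} (wf dt) dA v v′ _)
        (≤⟦⟧⇒≤̃ (≈-sym b≈B) (soundness dt (φ , x ≔ c) v′)))
  soundness {Γ} (app {x} {A} {B} {t} {u} dt du) φ v with domain-codomain x B dt
  -- `⟦Π⟧` and `⟦⟧-subst` need a codomain typed under its bound name, so the product is rewritten
  -- with the name `y` and codomain `B′` that inversion provides.
  ... | y , B′ , s , dA , dB′ , abs≡ with ⟦Π⟧ dA dB′ v
  ...   | S∈𝒜 , e =
    -- The meet of the context lies below itself and below `⟦ A ⟧ φ`, hence below their meet, which
    -- the adjunction bounds by the chosen instance `b`.
    ≤⟦⟧-trans (proj₂ (proj₂ (∧̃-infimum _ _)) _ ≤̃-refl ⋀≤A)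
      (≤̃⇒≤⟦⟧ (≈-sym ⟦B⟧≈) (Equivalence.to (Π̃-adjoint (_ , S∈𝒜)) ⋀≤Π b instance-u))
    where
    c = values (n<1+n (suc m)) u φ

    b∈𝓑 : ⟦ B′ ⟧ (φ , y ≔ c) ∈ᵛ 𝓑
    b∈𝓑 = ⟦_⟧∈𝓑 dB′ (⊨-extend {φ = φ} (wf dB′) v (values-elements _ φ du v))

    b : B̃
    b = ⟦ B′ ⟧ (φ , y ≔ c) , b∈𝓑

    instance-u : Instances y A B′ φ b
    instance-u = c , values-elements _ φ du v , ≈-refl

    ⟦B⟧≈ : ⟦ [ u / x ] B ⟧ φ ≈ proj₁ b
    ⟦B⟧≈ = subst (λ C → ⟦ C ⟧ φ ≈ proj₁ b) (sym (sub-abs x y B B′ u abs≡))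
      (⟦⟧-subst (typed dB′) du v)

    ⋀≤A : ⋀ {φ = φ} (wf dt) v ≤̃ (⟦ A ⟧ φ , ⟦ dA ⟧∈𝓑 v)
    ⋀≤A = ≲-respˡ-≈ (⋀-irrelevant {φ = φ} (wf du) (wf dt) v)
      (≤⟦⟧⇒≤̃ ≈-refl (soundness du φ v))

    ⋀≤Π : ⋀ {φ = φ} (wf dt) v ≤̃ Π̃ (⟦ A ⟧ φ , ⟦ dA ⟧∈𝓑 v) (_ , S∈𝒜)
    ⋀≤Π = ≤⟦⟧⇒≤̃ (subst (λ C → ⟦ pi A C ⟧ φ ≈ _) (sym abs≡) e) (soundness dt φ v)
  soundness (conv {A} s dA dB dt A≡B) φ v =
    let A∈𝓑 , ⋀≤A = soundness dt φ v in
    ≤̃⇒≤⟦⟧ {c = ⟦ A ⟧ φ , A∈𝓑} (conversion _ dA dB A≡B v)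
      (≲-respˡ-≈ (⋀-irrelevant {φ = φ} (wf dt) (wf dA) v) ⋀≤A)

theorem3p1 : ∀ {r ℓ o a : Level} (T : Theory r) →
    let open Theory T in
    Confluent _⟶_ → SubjectReduction →
    ∀ {m : ℕ} (M : Model T m ℓ) (𝓑 : V ℓ)
    (alg : ΠAlgebra (El 𝓑) o (Level.suc ℓ) a) (val : ValuedIn M 𝓑 alg) →
    IsModel val →
    let open Model M
        open ValuedIn val in
    ∀ {Γ t B} (d : Γ ⊢ t ∶ B) (φ : Vec (Valuation ℓ) (suc m)) (v : φ ⊨ Γ) →
    ⋀ {φ = φ} (wf d) v ≤⟦ B ⟧ φ
theorem3p1 T _ _ M 𝓑 alg val isModel = Soundness.soundness isModel
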